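{- Let $M$ be a model with borders and $U\subseteq M$ an up-set. The following are equivalent: (1) there is a $(\wedge,\to)$-formula $\varphi$ with $v(\varphi)=U$; (2) for all $x\in M$: if for every $z\in M^s$ with $z\ge x$ there exists $y\in U\cap M^s$ bisimilar to $z$ in $M^s$, then $x\in U$; (3) for all $x\in M$: (a) if all separated points $z\ge x$ are in $U$, then $x\in U$; and (b) if $x\in M^s$ and there exists $x'\in U\cap M^s$ bisimilar to $x$ in $M^s$, then $x\in U$.
   Context: Fix $n\ge1$ and variables $p_1,\dots,p_n$. A model is $(M,\le,c)$, $(M,\le)$ a poset, $c:M\to\{0,1\}^n$ order-preserving (componentwise order), with intuitionistic Kripke semantics ($x\models p_i$ iff $c(x)_i=1$; $x\models\varphi\to\psi$ iff every $y\ge x$ satisfying $\varphi$ satisfies $\psi$). $v(\varphi)$ is the set of points of $M$ satisfying $\varphi$. A $(\wedge,\to)$-formula uses only $\wedge,\to$. A point $x$ is a $q$-border point if $x\not\models q$ and all $y>x$ satisfy $q$; separated if it is a $q$-border point for some variable $q$. $M^s$ is the set of separated points with restricted order and colouring, a model in its own right, all of whose chains have at most $n$ elements. $M$ has borders if for every variable $p$ and $x$ with $x\not\models p$ there is a $p$-border point $y\ge x$. Two points of $M^s$ are bisimilar in $M^s$ if they are related by an intuitionistic bisimulation of the model $M^s$ (colour-preserving, with forth and back conditions for $\le$); equivalently, since $M^s$ has finite depth, they have the same image under the unique p-morphism from $M^s$ to the $n$-universal model $U(n)$. -}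

module Defs where

open import Data.Bool.Base as Bool using (Bool; true)
open import Data.Fin.Base using (Fin)
open import Data.Nat.Base using (ℕ)
open import Data.Product.Base using (Σ; ∃-syntax; _×_; _,_; proj₁)
open import Data.Vec.Functional using (Vector)
open import Data.Vec.Functional.Relation.Binary.Pointwise using (Pointwise)
open import Level using (Level; Lift; _⊔_) renaming (suc to lsuc)
open import Relation.Binary.Bundles using (Poset)
open import Relation.Binary.Core using (Rel; _Preserves_⟶_)
open import Relation.Binary.PropositionalEquality.Core using (_≡_; _≗_)
open import Relation.Nullary.Negation.Core using (¬_)
open import Relation.Unary using (Pred; _≐_)
import Relation.Binary.Construct.On as On
import Relation.Binary.Properties.Poset as PosetProperties

private
  variable
    n : ℕ
    c ℓ₁ ℓ₂ r u : Level

record Model (n : ℕ) (c ℓ₁ ℓ₂ : Level) : Set (lsuc (c ⊔ ℓ₁ ⊔ ℓ₂)) where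
  field
    poset : Poset c ℓ₁ ℓ₂

  open Poset poset public using (Carrier; _≈_; _≤_)
  open PosetProperties poset public using (_<_)

  field
    colour      : Carrier → Vector Bool n
    colour-mono : colour Preserves _≤_ ⟶ Pointwise Bool._≤_

infixr 7 _∧_
infixr 6 _⇒_

-- Formulas built with ∧ and → only; ⊤ is available as p → p when n ≥ 1.
data Formula (n : ℕ) : Set where
  var : Fin n → Formula n
  _∧_ : Formula n → Formula n → Formula n
  _⇒_ : Formula n → Formula n → Formula n

module _ (M : Model n c ℓ₁ ℓ₂) where
  open Model M

  infix 4 _⊨_

  _⊨_ : Carrier → Formula n → Set (c ⊔ ℓ₂)
  x ⊨ var i   = Lift (c ⊔ ℓ₂) (colour x i ≡ true)
  x ⊨ (φ ∧ ψ) = x ⊨ φ × x ⊨ ψ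
  x ⊨ (φ ⇒ ψ) = ∀ y → x ≤ y → y ⊨ φ → y ⊨ ψ

  v : Formula n → Pred Carrier (c ⊔ ℓ₂)
  v φ x = x ⊨ φ

  IsBorder : Fin n → Pred Carrier (c ⊔ ℓ₁ ⊔ ℓ₂)
  IsBorder q x = ¬ (x ⊨ var q) × (∀ y → x < y → y ⊨ var q)

  Separated : Pred Carrier (c ⊔ ℓ₁ ⊔ ℓ₂)
  Separated x = ∃[ q ] IsBorder q x

  HasBorders : Set (c ⊔ ℓ₁ ⊔ ℓ₂)
  HasBorders = ∀ p x → ¬ (x ⊨ var p) → ∃[ y ] (x ≤ y × IsBorder p y)

  record IsBisimulation (Z : Rel Carrier r) : Set (c ⊔ ℓ₂ ⊔ r) where
    field
      same-colour : ∀ {x y} → Z x y → colour x ≗ colour y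
      forth       : ∀ {x y} → Z x y → ∀ x′ → x ≤ x′ → ∃[ y′ ] (y ≤ y′ × Z x′ y′)
      back        : ∀ {x y} → Z x y → ∀ y′ → y ≤ y′ → ∃[ x′ ] (x ≤ x′ × Z x′ y′)

  Bisimilar : Rel Carrier (lsuc (c ⊔ ℓ₂))
  Bisimilar x y = Σ (Rel Carrier (c ⊔ ℓ₂)) λ Z → IsBisimulation Z × Z x y

-- The underlying order and equality compare first components only, so different
-- proofs that a point is separated give the same point.
separatedPart : Model n c ℓ₁ ℓ₂ → Model n (c ⊔ ℓ₁ ⊔ ℓ₂) ℓ₁ ℓ₂
separatedPart M = record
  { poset       = On.poset poset (proj₁ {B = Separated M})
  ; colour      = λ z → colour (proj₁ z)
  ; colour-mono = colour-mono
  }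
  where open Model M

module _ (M : Model n c ℓ₁ ℓ₂) (U : Pred (Model.Carrier M) u) where
  open Model M

  private
    Mˢ : Set (c ⊔ ℓ₁ ⊔ ℓ₂)
    Mˢ = Model.Carrier (separatedPart M)

    BisimilarToU : Pred Mˢ (lsuc (c ⊔ ℓ₁ ⊔ ℓ₂) ⊔ u)
    BisimilarToU z = ∃[ y ] (U (proj₁ y) × Bisimilar (separatedPart M) z y)

  Definable : Set (c ⊔ ℓ₂ ⊔ u)
  Definable = ∃[ φ ] (v M φ ≐ U)

  BisimilarityReflecting : Set (lsuc (c ⊔ ℓ₁ ⊔ ℓ₂) ⊔ u)
  BisimilarityReflecting =
    ∀ x → (∀ (z : Mˢ) → x ≤ proj₁ z → BisimilarToU z) → U x

  SeparatedDetermined : Set (lsuc (c ⊔ ℓ₁ ⊔ ℓ₂) ⊔ u)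
  SeparatedDetermined =
    ∀ x → ((∀ z → Separated M z → x ≤ z → U z) → U x)
        × ((s : Separated M x) → BisimilarToU (x , s) → U x)

{-# OPTIONS --safe #-}
module Submission where

open import Defs
open import Axiom.ExcludedMiddle using (ExcludedMiddle)
open import Data.Bool.Base as Bool using (true)
import Data.Bool.Properties as Bool
open import Data.Fin.Base using (Fin; fromℕ<)
open import Data.Fin.Subset using (Subset; ∁; ∣_∣) renaming (_∈_ to _∈ₛ_)
open import Data.Fin.Subset.Properties using (∣p∣≤n; p⊂q⇒∣p∣<∣q∣; x∈p⇒x∉∁p; x∉p⇒x∈∁p; x∈∁p⇒x∉p)
open import Data.List.Base using (List; []; _∷_; _++_; map; concatMap; filter; foldr; allFin)
open import Data.List.Membership.Propositional using (_∈_)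
open import Data.List.Membership.Propositional.Properties
  using (∈-++⁺ˡ; ∈-++⁺ʳ; ∈-map⁺; ∈-allFin; ∈-filter⁺)
open import Data.List.Relation.Binary.Subset.Propositional using (_⊆_)
open import Data.List.Relation.Unary.All as All using (All; []; _∷_)
open import Data.List.Relation.Unary.All.Properties using (all-filter)
open import Data.List.Relation.Unary.Any using (here; there)
import Data.List.Relation.Unary.Any.Properties as Any
open import Data.Nat.Base using (ℕ; zero; suc; NonZero; >-nonZero⁻¹; s≤s; _≤′_; ≤′-refl; ≤′-step)
  renaming (_<_ to _<ₙ_)
open import Data.Nat.Properties using (≤⇒≤′)
open import Data.Product.Base using (∃-syntax; _×_; _,_; proj₁; proj₂; map₂)
open import Data.Vec.Base using (tabulate)
open import Data.Vec.Properties using (tabulate-cong; lookup∘tabulate; []=⇒lookup; lookup⇒[]=)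
open import Function.Base using (_∘_; flip)
open import Function.Bundles using (_⇔_; mk⇔; module Equivalence)
open import Function.Construct.Composition using (_⇔-∘_)
open import Function.Construct.Symmetry using (⇔-sym)
open import Level using (Level; Lift; lift; lower; _⊔_)
open import Relation.Binary.Bundles using (Poset)
open import Relation.Binary.Core using (Rel)
open import Relation.Binary.Definitions using (_Respects_)
open import Relation.Binary.PropositionalEquality.Core using (_≡_; _≗_; refl; sym; trans; cong; subst)
open import Relation.Nullary.Decidable.Core using (Dec; yes; no; decidable-stable)
open import Relation.Nullary.Negation.Core using (¬_; contradiction)
open import Relation.Unary using (Pred)

-- A formula that fails at x already fails at a separated point above x, so up-sets
-- definable in the (∧, →)-fragment are governed by Mˢ.  For the converse, a q-border
-- point w is described up to agreement on a finite set Γ of formulas by the implication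
-- whose conclusion is q and whose premises are the γ ∈ Γ true at w and the γ ⇒ q for the
-- other γ ∈ Γ: it fails exactly below the q-border points that agree with w on Γ.
-- Adding all these implications to Γ repeatedly, starting from the variables, agreement at
-- the stage given by the number of variables false at a point is a bisimulation on Mˢ.
-- So U is defined by the conjunction of the formulas of a late stage that are valid on U.

private
  variable
    n : ℕ
    c ℓ₁ ℓ₂ r u : Level

-- Finite conjunctions and the stages of formulas.

verum : .{{NonZero n}} → Formula n
verum {n} = var q ⇒ var q
  where q = fromℕ< (>-nonZero⁻¹ n)

⋀ : .{{NonZero n}} → List (Formula n) → Formula n
⋀ = foldr _∧_ verum

-- One formula for each way of splitting `Γ` into true and false members. No model is mentioned, so
-- the list stays finite even over an infinite model.
diagrams : Fin n → List (Formula n) → List (Formula n)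
diagrams q []      = var q ∷ []
diagrams q (γ ∷ Γ) = map (γ ⇒_) (diagrams q Γ) ++ map ((γ ⇒ var q) ⇒_) (diagrams q Γ)

stage : ∀ n → ℕ → List (Formula n)
stage n zero    = map var (allFin n)
stage n (suc k) = stage n k ++ concatMap (λ q → diagrams q (stage n k)) (allFin n)

stage-mono : ∀ {j k} → j ≤′ k → stage n j ⊆ stage n k
stage-mono ≤′-refl       φ∈ = φ∈
stage-mono (≤′-step j≤k) φ∈ = ∈-++⁺ˡ (stage-mono j≤k φ∈)

var∈stage : ∀ k (p : Fin n) → var p ∈ stage n k
var∈stage zero    p = ∈-map⁺ var (∈-allFin p)
var∈stage (suc k) p = ∈-++⁺ˡ (var∈stage k p)

diagrams⊆stage : ∀ k (q : Fin n) → diagrams q (stage n k) ⊆ stage n (suc k)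
diagrams⊆stage {n} k q φ∈ = ∈-++⁺ʳ (stage n k)
  (Any.concatMap⁺ (λ q → diagrams q (stage n k)) (Any.tabulate⁺ q φ∈))

-- Symmetry and reflexivity of bisimilarity.

IsBisimulation-flip : (M : Model n c ℓ₁ ℓ₂) {Z : Rel (Model.Carrier M) r} →
                      IsBisimulation M Z → IsBisimulation M (flip Z)
IsBisimulation-flip M B = record
  { same-colour = λ z i → sym (same-colour z i)
  ; forth       = back
  ; back        = forth
  }
  where open IsBisimulation B

Bisimilar-refl : (M : Model n c ℓ₁ ℓ₂) → ∀ x → Bisimilar M x x
Bisimilar-refl {c = c} {ℓ₂ = ℓ₂} M x =
  (λ x y → Lift (c ⊔ ℓ₂) (x ≡ y)) ,
  record
    { same-colour = λ { (lift refl) _ → refl }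
    ; forth       = λ { (lift refl) x′ x≤x′ → x′ , x≤x′ , lift refl }
    ; back        = λ { (lift refl) y′ y≤y′ → y′ , y≤y′ , lift refl }
    } ,
  lift refl

-- Persistence, agreement and rank.

module _ (M : Model n c ℓ₁ ℓ₂) where
  open Model M
  open Poset poset using (module Eq) renaming (trans to ≤-trans; reflexive to ≤-reflexive)

  private
    infix 4 _⊩_

    _⊩_ : Carrier → Formula n → Set (c ⊔ ℓ₂)
    _⊩_ = _⊨_ M

  ⊨-persistent : ∀ φ {x y} → x ≤ y → x ⊩ φ → y ⊩ φ
  ⊨-persistent (var i)   {x} {y} x≤y (lift xi) = lift (go (colour-mono x≤y i) xi)
    where
    go : ∀ {a b} → a Bool.≤ b → a ≡ true → b ≡ true
    go Bool.b≤b a≡true = a≡true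
    go Bool.f≤t _      = refl
  ⊨-persistent (φ ∧ ψ) x≤y (xφ , xψ) = ⊨-persistent φ x≤y xφ , ⊨-persistent ψ x≤y xψ
  ⊨-persistent (φ ⇒ ψ) x≤y xφψ z y≤z = xφψ z (≤-trans x≤y y≤z)

  ⋀-intro : .{{_ : NonZero n}} {Γ : List (Formula n)} {x : Carrier} →
            All (x ⊩_) Γ → x ⊩ ⋀ Γ
  ⋀-intro []       = λ _ _ yq → yq
  ⋀-intro (h ∷ hs) = h , ⋀-intro hs

  ⋀-elim : .{{_ : NonZero n}} {Γ : List (Formula n)} {x : Carrier} →
           x ⊩ ⋀ Γ → ∀ {φ} → φ ∈ Γ → x ⊩ φ
  ⋀-elim (h , _) (here refl) = h
  ⋀-elim (_ , h) (there φ∈)  = ⋀-elim h φ∈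

  Agree : List (Formula n) → Rel Carrier (c ⊔ ℓ₂)
  Agree Γ x y = All (λ γ → x ⊩ γ ⇔ y ⊩ γ) Γ

  Agree-trans : ∀ {Γ x y z} → Agree Γ x y → Agree Γ y z → Agree Γ x z
  Agree-trans xy yz = All.zipWith (λ (e , e′) → e′ ⇔-∘ e) (xy , yz)

  ≈⇒Agree : ∀ {Γ x y} → x ≈ y → Agree Γ x y
  ≈⇒Agree x≈y = All.universal
    (λ γ → mk⇔ (⊨-persistent γ (≤-reflexive x≈y)) (⊨-persistent γ (≤-reflexive (Eq.sym x≈y)))) _

  Agree⇒same-colour : ∀ {k x y} → Agree (stage n k) x y → colour x ≗ colour y
  Agree⇒same-colour {k} {x} {y} agree i = Bool.⇔→≡ (mk⇔ (lower ∘ to ∘ lift) (lower ∘ from ∘ lift))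
    where open Equivalence (All.lookup agree (var∈stage k i))

  truths : Carrier → Subset n
  truths x = tabulate (colour x)

  rank : Carrier → ℕ
  rank x = ∣ ∁ (truths x) ∣

  rank-cong : ∀ {x y} → colour x ≗ colour y → rank x ≡ rank y
  rank-cong = cong (∣_∣ ∘ ∁) ∘ tabulate-cong

  ∈-truths⁺ : ∀ {x i} → x ⊩ var i → i ∈ₛ truths x
  ∈-truths⁺ {x} {i} (lift xi) =
    lookup⇒[]= i (truths x) (trans (lookup∘tabulate (colour x) i) xi)

  ∈-truths⁻ : ∀ {x i} → i ∈ₛ truths x → x ⊩ var i
  ∈-truths⁻ {x} {i} i∈ = lift (trans (sym (lookup∘tabulate (colour x) i)) ([]=⇒lookup i∈))

  -- By persistence no variable becomes false on the way up, and `i` stops being false.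
  rank-decreasing : ∀ {x y i} → x ≤ y → ¬ x ⊩ var i → y ⊩ var i →
                    rank y <ₙ rank x
  rank-decreasing {x} {y} x≤y ¬xi yi = p⊂q⇒∣p∣<∣q∣
    ( (λ {j} j∈ → x∉p⇒x∈∁p λ j∈x →
        x∈∁p⇒x∉p j∈ (∈-truths⁺ (⊨-persistent (var j) x≤y (∈-truths⁻ j∈x))))
    , _ , x∉p⇒x∈∁p (¬xi ∘ ∈-truths⁻) , x∈p⇒x∉∁p (∈-truths⁺ yi))

-- Reduction to separated points.

module _ (em : ∀ {ℓ} → ExcludedMiddle ℓ) (M : Model n c ℓ₁ ℓ₂) (borders : HasBorders M) where
  open Model M
  open Poset poset using (module Eq)
    renaming (refl to ≤-refl; trans to ≤-trans; reflexive to ≤-reflexive)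

  private
    infix 4 _⊩_ _≋_

    _⊩_ : Carrier → Formula n → Set (c ⊔ ℓ₂)
    _⊩_ = _⊨_ M

    Mˢ : Set _
    Mˢ = Model.Carrier (separatedPart M)

  ¬⇒-witness : ∀ {φ ψ x} → ¬ x ⊩ φ ⇒ ψ →
               ∃[ y ] (x ≤ y × y ⊩ φ × ¬ y ⊩ ψ)
  ¬⇒-witness ¬xφψ = decidable-stable em λ ¬∃ → ¬xφψ λ y x≤y yφ →
    decidable-stable em λ ¬yψ → ¬∃ (y , x≤y , yφ , ¬yψ)

  -- Borders settle the variables. For an implication, first go up to a point where the premise
  -- holds and the conclusion fails, then to a separated point refuting the conclusion; the premise
  -- persists there.
  separated-refutation : ∀ φ {x} → ¬ x ⊩ φ →
                         ∃[ z ] (x ≤ proj₁ z × ¬ proj₁ {B = Separated M} z ⊩ φ)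
  separated-refutation (var i) ¬xi =
    let y , x≤y , yᵇ = borders i _ ¬xi in (y , i , yᵇ) , x≤y , proj₁ yᵇ
  separated-refutation (φ ∧ ψ) {x} ¬xφψ with em {P = x ⊩ φ}
  ... | yes xφ =
    map₂ (map₂ λ ¬zψ zφψ → ¬zψ (proj₂ zφψ)) (separated-refutation ψ λ xψ → ¬xφψ (xφ , xψ))
  ... | no ¬xφ = map₂ (map₂ λ ¬zφ zφψ → ¬zφ (proj₁ zφψ)) (separated-refutation φ ¬xφ)
  separated-refutation (φ ⇒ ψ) ¬xφψ =
    let y , x≤y , yφ , ¬yψ = ¬⇒-witness ¬xφψ
        z , y≤z , ¬zψ      = separated-refutation ψ ¬yψ
    in z , ≤-trans x≤y y≤z , λ zφψ → ¬zψ (zφψ _ ≤-refl (⊨-persistent M φ y≤z yφ))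

  -- Forcing is taken in `M`, whereas `Z` only relates points of `Mˢ`. A point refuting an
  -- implication is therefore first moved up to a separated one, to which the back condition
  -- applies.
  bisimulation-invariant : ∀ φ {Z : Rel Mˢ r} → IsBisimulation (separatedPart M) Z →
                           ∀ {x y} → Z x y → proj₁ x ⊩ φ → proj₁ y ⊩ φ
  bisimulation-invariant (var i) B z (lift xi) =
    lift (trans (sym (IsBisimulation.same-colour B z i)) xi)
  bisimulation-invariant (φ ∧ ψ) B z (xφ , xψ) =
    bisimulation-invariant φ B z xφ , bisimulation-invariant ψ B z xψ
  bisimulation-invariant (φ ⇒ ψ) B z xφψ y′ y≤y′ y′φ = decidable-stable em λ ¬y′ψ →
    let w , y′≤w , ¬wψ  = separated-refutation ψ ¬y′ψ
        x′ , x≤x′ , x′w = IsBisimulation.back B z w (≤-trans y≤y′ y′≤w)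
        x′φ = bisimulation-invariant φ (IsBisimulation-flip (separatedPart M) B) x′w
                (⊨-persistent M φ y′≤w y′φ)
    in ¬wψ (bisimulation-invariant ψ B x′w (xφψ _ x≤x′ x′φ))

  -- Diagrams of border points.

  record IsDiagram (q : Fin n) (Γ : List (Formula n)) (w : Carrier) (ψ : Formula n) :
                   Set (c ⊔ ℓ₁ ⊔ ℓ₂) where
    field
      ∈-diagrams : ψ ∈ diagrams q Γ
      refuted    : ¬ w ⊩ ψ
      realised   : ∀ {y} → ¬ y ⊩ ψ → ∃[ y′ ] (y ≤ y′ × IsBorder M q y′ × Agree M Γ w y′)

  open IsDiagram

  -- Induction on `Γ`. A premise `γ` persists up to the border point found for the shorter list; a
  -- premise `γ ⇒ var q` makes `γ` fail there, because `q` does.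
  diagram : ∀ {q w} → IsBorder M q w → ∀ Γ → ∃[ ψ ] IsDiagram q Γ w ψ
  diagram {q} {w} (¬wq , _) [] = var q , record
    { ∈-diagrams = here refl
    ; refuted    = ¬wq
    ; realised   = λ ¬yq → map₂ (map₂ (_, [])) (borders q _ ¬yq)
    }
  diagram {q} {w} wᵇ@(¬wq , w<) (γ ∷ Γ) with diagram wᵇ Γ | em {P = w ⊩ γ}
  ... | ψ , d | yes wγ = (γ ⇒ ψ) , record
    { ∈-diagrams = ∈-++⁺ˡ (∈-map⁺ (γ ⇒_) (∈-diagrams d))
    ; refuted    = λ wγψ → refuted d (wγψ w ≤-refl wγ)
    ; realised   = λ ¬yγψ →
        let y₁ , y≤y₁ , y₁γ , ¬y₁ψ = ¬⇒-witness ¬yγψ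
            y₂ , y₁≤y₂ , y₂ᵇ , agree = realised d ¬y₁ψ
        in y₂ , ≤-trans y≤y₁ y₁≤y₂ , y₂ᵇ ,
           mk⇔ (λ _ → ⊨-persistent M γ y₁≤y₂ y₁γ) (λ _ → wγ) ∷ agree
    }
  ... | ψ , d | no ¬wγ = ((γ ⇒ var q) ⇒ ψ) , record
    { ∈-diagrams = ∈-++⁺ʳ _ (∈-map⁺ ((γ ⇒ var q) ⇒_) (∈-diagrams d))
    ; refuted    = λ wγqψ → refuted d (wγqψ w ≤-refl wγq)
    ; realised   = λ ¬yγqψ →
        let y₁ , y≤y₁ , y₁γq , ¬y₁ψ = ¬⇒-witness ¬yγqψ
            y₂ , y₁≤y₂ , y₂ᵇ , agree = realised d ¬y₁ψ
        in y₂ , ≤-trans y≤y₁ y₁≤y₂ , y₂ᵇ ,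
           mk⇔ (λ wγ → contradiction wγ ¬wγ)
               (λ y₂γ → contradiction (y₁γq y₂ y₁≤y₂ y₂γ) (proj₁ y₂ᵇ)) ∷ agree
    }
    where
    wγq : w ⊩ γ ⇒ var q
    -- Since `γ` fails at `w`, the point `y` lies strictly above `w`, where the border property
    -- yields `q`.
    wγq y w≤y yγ = w< y (w≤y , λ w≈y → ¬wγ (⊨-persistent M γ (≤-reflexive (Eq.sym w≈y)) yγ))

  -- Agreement as a bisimulation on the separated points.

  _≋_ : Rel Mˢ (c ⊔ ℓ₁ ⊔ ℓ₂)
  x ≋ y = Lift ℓ₁ (Agree M (stage n (rank M (proj₁ x))) (proj₁ x) (proj₁ y))

  ≋-same-colour : ∀ {x y} → x ≋ y → colour (proj₁ x) ≗ colour (proj₁ y)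
  ≋-same-colour {x} (lift agree) = Agree⇒same-colour M {k = rank M (proj₁ x)} agree

  -- The left point alone selects the stage, but agreeing points have equal colours and hence equal
  -- ranks.
  ≋-sym : ∀ {x y} → x ≋ y → y ≋ x
  ≋-sym {x} {y} z@(lift agree) = lift (subst (λ k → Agree M (stage n k) (proj₁ y) (proj₁ x))
    (rank-cong M (≋-same-colour {x} {y} z)) (All.map ⇔-sym agree))

  ≋-forth : ∀ {x y} → x ≋ y → ∀ x′ → proj₁ x ≤ proj₁ x′ → ∃[ y′ ] (proj₁ y ≤ proj₁ y′ × x′ ≋ y′)
  ≋-forth {x , q , ¬xq , x<} {y , yˢ} (lift agree) (x′ , q′ , x′ᵇ) x≤x′ with em {P = x ≈ x′}
  ... | yes x≈x′ = (y , yˢ) , ≤-refl , lift (subst (λ k → Agree M (stage n k) x′ y)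
    (rank-cong M (Agree⇒same-colour M {k = 0} (≈⇒Agree M x≈x′)))
    (Agree-trans M (≈⇒Agree M (Eq.sym x≈x′)) agree))
  ... | no x≉x′ =
    let ψ , d = diagram x′ᵇ (stage n (rank M x′))
        -- `q` fails at the border point `x` and holds at `x′`, so the rank drops. This pays for the
        -- one extra stage in which the diagram of `x′` appears.
        x′<x  = rank-decreasing M x≤x′ ¬xq (x< x′ (x≤x′ , x≉x′))
        ψ∈    = stage-mono (≤⇒≤′ x′<x) (diagrams⊆stage (rank M x′) q′ (∈-diagrams d))
        ¬yψ   = λ yψ → refuted d (⊨-persistent M ψ x≤x′ (Equivalence.from (All.lookup agree ψ∈) yψ))
        y′ , y≤y′ , y′ᵇ , agree′ = realised d ¬yψ
    in (y′ , q′ , y′ᵇ) , y≤y′ , lift agree′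

  ≋-isBisimulation : IsBisimulation (separatedPart M) _≋_
  ≋-isBisimulation = record
    { same-colour = λ {x} {y} → ≋-same-colour {x} {y}
    ; forth       = λ {x} {y} → ≋-forth {x} {y}
    ; back        = λ {x} {y} z y′ y≤y′ →
        let x′ , x≤x′ , z′ = ≋-forth {y} {x} (≋-sym {x} {y} z) y′ y≤y′
        in x′ , x≤x′ , ≋-sym {y′} {x′} z′
    }

  -- The equivalences.

  module _ (U : Pred Carrier u) (U-up : U Respects _≤_) where

    definable⇒reflecting : Definable M U → BisimilarityReflecting M U
    definable⇒reflecting (φ , vφ⊆U , U⊆vφ) x h = decidable-stable em λ ¬Ux →
      let z , x≤z , ¬zφ       = separated-refutation φ (¬Ux ∘ vφ⊆U)
          y , Uy , Z , B , zy = h z x≤z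
      in ¬zφ (bisimulation-invariant φ (IsBisimulation-flip (separatedPart M) B) zy (U⊆vφ Uy))

    -- For (a), each separated point is its own bisimilar partner. For (b), the forth condition
    -- supplies a partner above `y`, which is in `U` as `U` is an up-set.
    reflecting⇒determined : BisimilarityReflecting M U → SeparatedDetermined M U
    reflecting⇒determined refl-U x =
      (λ h → refl-U x λ z x≤z → z , h _ (proj₂ z) x≤z , Bisimilar-refl (separatedPart M) z) ,
      (λ s (y , Uy , Z , B , xy) → refl-U x λ z x≤z →
        let y′ , y≤y′ , zy′ = IsBisimulation.forth B xy z x≤z
        in y′ , U-up y≤y′ Uy , Z , B , zy′)

    determined⇒reflecting : SeparatedDetermined M U → BisimilarityReflecting M U
    determined⇒reflecting det x h =
      proj₁ (det x) λ z s x≤z → proj₂ (det z) s (h (z , s) x≤z)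

    -- If a separated `z` is outside `U`, its diagram is valid on `U`: a failure in `U` would
    -- produce a point of `U` bisimilar to `z`, against (b). So the diagram is a conjunct, and it
    -- fails at `z`. Then (a) passes from separated points to all points.
    determined⇒definable : .{{_ : NonZero n}} → SeparatedDetermined M U → Definable M U
    determined⇒definable det = ⋀ Γ , vΓ⊆U , U⊆vΓ
      where
      Valid : Pred (Formula n) _
      Valid ψ = ∀ y → U y → y ⊩ ψ

      valid? : ∀ ψ → Dec (Valid ψ)
      valid? ψ = em

      Γ : List (Formula n)
      -- Ranks are at most `n`, and a diagram over stage `k` lies in stage `suc k`.
      Γ = filter valid? (stage n (suc n))

      U⊆vΓ : ∀ {x} → U x → x ⊩ ⋀ Γ
      U⊆vΓ Ux = ⋀-intro M (All.map (λ valid → valid _ Ux) (all-filter valid? (stage n (suc n))))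

      vΓ⊆U : ∀ {x} → x ⊩ ⋀ Γ → U x
      vΓ⊆U {x} xΓ = proj₁ (det x) λ where
        z s@(q , zᵇ) x≤z → decidable-stable em λ ¬Uz →
          let k     = rank M z
              ψ , d = diagram zᵇ (stage n k)
              ψ∈    = stage-mono (≤⇒≤′ (s≤s (∣p∣≤n (∁ (truths M z)))))
                        (diagrams⊆stage k q (∈-diagrams d))
              valid = λ y Uy → decidable-stable em λ ¬yψ →
                let y′ , y≤y′ , y′ᵇ , agree = realised d ¬yψ
                in ¬Uz (proj₂ (det z) s
                     ((y′ , q , y′ᵇ) , U-up y≤y′ Uy , _≋_ , ≋-isBisimulation , lift agree))
          in refuted d (⊨-persistent M ψ x≤z (⋀-elim M xΓ (∈-filter⁺ valid? ψ∈ valid)))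

theorem3p19 : (∀ {ℓ} → ExcludedMiddle ℓ) →
    ∀ {c ℓ₁ ℓ₂ u} (n : ℕ) .{{_ : NonZero n}} (M : Model n c ℓ₁ ℓ₂) → HasBorders M →
    (U : Pred (Model.Carrier M) u) → U Respects (Model._≤_ M) →
    (Definable M U ⇔ BisimilarityReflecting M U) ×
    (BisimilarityReflecting M U ⇔ SeparatedDetermined M U)
theorem3p19 em n M borders U U-up =
  mk⇔ (definable⇒reflecting em M borders U U-up)
      (determined⇒definable em M borders U U-up ∘ reflecting⇒determined em M borders U U-up) ,
  mk⇔ (reflecting⇒determined em M borders U U-up) (determined⇒reflecting em M borders U U-up)
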